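{- For every positive integer $n$, the initial three-row Chomp rectangle $[n,n,n]$ has exactly one winning opening move; that is, there is exactly one legal move from $[n,n,n]$ that leads to a $P$-position.
   Context: Three-row Chomp. A position is a triple $[p,q,r]$ of integers with $p\ge q\ge r\ge 0$, giving the lengths of the first, second and third rows of a left-justified board. Two players alternate moves. A move chooses a square $(i,j)$ still present (row $i$, column $j$) and removes all squares $(i',j')$ with $i'\ge i$ and $j'\ge j$. Thus the moves from $[p,q,r]$ are: reduce the first row to length $a$ with $0\le a<p$, giving $[a,\min(a,q),\min(a,r)]$; reduce the second row to length $a$ with $0\le a<q$, giving $[p,a,\min(a,r)]$; reduce the third row to length $b$ with $0\le b<r$, giving $[p,q,b]$. The player who takes the square $(1,1)$ (i.e. moves to $[0,0,0]$) loses. A $P$-position is a position from which the previous player (the one who just moved) wins, and an $N$-position is one from which the player about to move wins. Equivalently: $[0,0,0]$ is an $N$-position, and a position other than $[0,0,0]$ is a $P$-position if and only if no move from it leads to a $P$-position. A move is winning if it leads to a $P$-position. -}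

module Defs where

open import Data.Fin using (Fin; toℕ)
open import Data.Fin.Properties using (toℕ<n)
open import Data.Nat using (ℕ; _≤_; _⊓_; z≤n)
open import Data.Nat.Properties using (≤-refl; ≤-trans; <⇒≤; m⊓n≤m; ⊓-monoʳ-≤)
open import Relation.Binary.PropositionalEquality using (_≢_)

-- The bounds are irrelevant, so positions with equal row lengths are equal.
record Position : Set where
  constructor position
  field
    p q r : ℕ
    .q≤p  : q ≤ p
    .r≤q  : r ≤ q

open Position public using (p; q; r)

empty : Position
empty = position 0 0 0 z≤n z≤n

rectangle : ℕ → Position
rectangle n = position n n n ≤-refl ≤-refl

-- A move is a square of the board.  Columns are counted from 0, so the index
-- of the chosen column is the new length of the chosen row.
data Move (x : Position) : Set where
  row₁ : Fin (p x) → Move x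
  row₂ : Fin (q x) → Move x
  row₃ : Fin (r x) → Move x

play : (x : Position) → Move x → Position
play (position p q r q≤p r≤q) (row₁ a) =
  position (toℕ a) (toℕ a ⊓ q) (toℕ a ⊓ r) (m⊓n≤m (toℕ a) q) (⊓-monoʳ-≤ (toℕ a) r≤q)
play (position p q r q≤p r≤q) (row₂ a) =
  position p (toℕ a) (toℕ a ⊓ r) (≤-trans (<⇒≤ (toℕ<n a)) q≤p) (m⊓n≤m (toℕ a) r)
play (position p q r q≤p r≤q) (row₃ b) =
  position p q (toℕ b) q≤p (≤-trans (<⇒≤ (toℕ<n b)) r≤q)

-- Whoever moves to the empty board loses, so the player facing it has won:
-- it is an N-position.  Every game is finite, so the least solution of the
-- recursion given by these constructors is the only one.
data IsP (x : Position) : Set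
data IsN : Position → Set

data IsP x where
  allMovesToN : x ≢ empty → (∀ m → IsN (play x m)) → IsP x

data IsN where
  emptyIsN    : IsN empty
  someMoveToP : ∀ {x} (m : Move x) → IsP (play x m) → IsN x

Winning : (x : Position) → Move x → Set
Winning x m = IsP (play x m)

-- A P-position admits no move to a P-position, so two winning openings in the
-- same row would be reachable from one another, and by strategy stealing the
-- winning opening is never in the first row.  It remains to exclude that
-- [n,n,b] and [n,a,a] are both P.  If a ≤ b, the second is reachable from the
-- first.  For b < a the key fact is: if [n,n,b] is P and b ≤ q ≤ n, then
-- [n,q,r] is P for some r ≤ b; with q = a this contradicts [n,a,a] being P.
-- The key fact goes by downward induction on q.  Each q′ with q < q′ ≤ n has
-- an r′ ≤ b with [n,q′,r′] P, and these n − q values r′ are distinct.  No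
-- [n,q,r′] is P, and its winning move cannot be in the second row.  If one is
-- in the third row, we are done.  Otherwise they all lead to P-positions
-- [s,q,r′] with q < s < n and distinct s, but only n − q − 1 values s exist.
module Submission where

open import Data.Fin using (Fin; zero; suc; toℕ; fromℕ<)
open import Data.Fin.Properties using (toℕ<n; toℕ-fromℕ<; toℕ-injective; fromℕ<-injective; pigeonhole)
open import Data.Nat using (ℕ; zero; suc; _+_; _∸_; _≤_; _<_; _⊓_; s≤s; s≤s⁻¹; NonZero)
open import Data.Nat.Induction using (<-rec)
open import Data.Nat.Properties
open import Data.Product using (∃; ∃₂; ∃!; _×_; _,_; proj₁; proj₂)
open import Data.Sum using (_⊎_; inj₁; inj₂; [_,_]′)
open import Function using (_∘_)
open import Relation.Binary.Definitions using (tri<; tri≈; tri>)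
open import Relation.Binary.PropositionalEquality using (_≡_; _≢_; refl; sym; trans; cong; subst)
open import Relation.Nullary using (¬_; contradiction)
open import Defs

position-cong : ∀ {p q r p′ q′ r′}
  .{q≤p : q ≤ p} .{r≤q : r ≤ q} .{q′≤p′ : q′ ≤ p′} .{r′≤q′ : r′ ≤ q′} →
  p ≡ p′ → q ≡ q′ → r ≡ r′ →
  position p q r q≤p r≤q ≡ position p′ q′ r′ q′≤p′ r′≤q′
position-cong refl refl refl = refl

IsN⇒¬IsP : ∀ {x} → IsN x → ¬ IsP x
IsN⇒¬IsP emptyIsN          (allMovesToN x≢∅ _) = x≢∅ refl
IsN⇒¬IsP (someMoveToP m p) (allMovesToN _ f)   = IsN⇒¬IsP (f m) p

search : ∀ {n} {A B : Fin n → Set} → (∀ i → A i ⊎ B i) → ∃ A ⊎ (∀ i → B i)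
search {zero}  _ = inj₂ λ ()
search {suc n} f with f zero | search (f ∘ suc)
... | inj₁ a | _            = inj₁ (zero , a)
... | inj₂ _ | inj₁ (i , a) = inj₁ (suc i , a)
... | inj₂ b | inj₂ bs      = inj₂ λ { zero → b ; (suc i) → bs i }

searchMoves : ∀ {x} {A B : Move x → Set} → (∀ m → A m ⊎ B m) → ∃ A ⊎ (∀ m → B m)
searchMoves f with search (f ∘ row₁) | search (f ∘ row₂) | search (f ∘ row₃)
... | inj₁ (i , a) | _            | _            = inj₁ (row₁ i , a)
... | inj₂ _       | inj₁ (i , a) | _            = inj₁ (row₂ i , a)
... | inj₂ _       | inj₂ _       | inj₁ (i , a) = inj₁ (row₃ i , a)
... | inj₂ f₁      | inj₂ f₂      | inj₂ f₃      =
  inj₂ λ { (row₁ i) → f₁ i ; (row₂ i) → f₂ i ; (row₃ i) → f₃ i }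

size : Position → ℕ
size x = p x + (q x + r x)

play-smaller : ∀ x m → size (play x m) < size x
play-smaller (position p q r _ _) (row₁ a) =
  +-mono-<-≤ (toℕ<n a) (+-mono-≤ (m⊓n≤n (toℕ a) q) (m⊓n≤n (toℕ a) r))
play-smaller (position p q r _ _) (row₂ a) =
  +-monoʳ-< p (+-mono-<-≤ (toℕ<n a) (m⊓n≤n (toℕ a) r))
play-smaller (position p q r _ _) (row₃ b) =
  +-monoʳ-< p (+-monoʳ-< q (toℕ<n b))

-- Every move removes a square, so strong induction on `size` applies; a search over the finitely
-- many moves decides each position constructively.
determined : ∀ x → IsP x ⊎ IsN x
determined x = <-rec (λ s → ∀ x → size x ≡ s → IsP x ⊎ IsN x) step (size x) x refl
  where
  step : ∀ s → (∀ {t} → t < s → ∀ x → size x ≡ t → IsP x ⊎ IsN x) →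
         ∀ x → size x ≡ s → IsP x ⊎ IsN x
  step _ _   (position zero zero zero _ _)    _ = inj₂ emptyIsN
  step _ _   (position zero zero (suc _) _ ())
  step _ _   (position zero (suc _) _ () _)
  step _ rec x@(position (suc _) _ _ _ _) refl
    with searchMoves (λ m → rec (play-smaller x m) (play x m) refl)
  ... | inj₁ (m , isP) = inj₂ (someMoveToP m isP)
  ... | inj₂ allN      = inj₁ (allMovesToN (λ ()) allN)

¬IsP⇒IsN : ∀ {x} → ¬ IsP x → IsN x
¬IsP⇒IsN {x} ¬isP = [ (λ isP → contradiction isP ¬isP) , (λ isN → isN) ]′ (determined x)

-- The bounds are kept as relevant components because they cannot be recovered from the irrelevant
-- fields of a `Position`.
P[_,_,_] : ℕ → ℕ → ℕ → Set
P[ p , q , r ] = ∃₂ λ (q≤p : q ≤ p) (r≤q : r ≤ q) → IsP (position p q r q≤p r≤q)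

no-P-move : ∀ {x y} → IsP x → (m : Move x) → play x m ≡ y → ¬ IsP y
no-P-move (allMovesToN _ f) m refl = IsN⇒¬IsP (f m)

module _ {p q r : ℕ} (P : P[ p , q , r ]) {a : ℕ} where

  ¬row₁ : ∀ {q′ r′} → a < p → q′ ≡ a ⊓ q → r′ ≡ a ⊓ r → ¬ P[ a , q′ , r′ ]
  ¬row₁ a<p refl refl (_ , _ , isP) =
    no-P-move (proj₂ (proj₂ P)) (row₁ (fromℕ< a<p))
      (position-cong a≡ (cong (_⊓ q) a≡) (cong (_⊓ r) a≡)) isP
    where a≡ = toℕ-fromℕ< a<p

  ¬row₂ : ∀ {r′} → a < q → r′ ≡ a ⊓ r → ¬ P[ p , a , r′ ]
  ¬row₂ a<q refl (_ , _ , isP) =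
    no-P-move (proj₂ (proj₂ P)) (row₂ (fromℕ< a<q))
      (position-cong refl a≡ (cong (_⊓ r) a≡)) isP
    where a≡ = toℕ-fromℕ< a<q

  ¬row₃ : a < r → ¬ P[ p , q , a ]
  ¬row₃ a<r (_ , _ , isP) =
    no-P-move (proj₂ (proj₂ P)) (row₃ (fromℕ< a<r))
      (position-cong refl refl (toℕ-fromℕ< a<r)) isP

-- As `r ≤ q`, cutting the second row of the P-position [n,q′,r] gives [n,q,r], which is therefore
-- N. Its winning move cannot have a result that [n,q′,r] also reaches in one move; the two
-- alternatives are what remains.
winning-reply : ∀ {n q q′ r} → P[ n , q′ , r ] → r ≤ q → q < q′ →
  (∃ λ r′ → r′ < r × P[ n , q , r′ ]) ⊎ (∃ λ s → q < s × s < n × P[ s , q , r ])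
winning-reply {n} {q} {q′} {r} P@(q′≤n , _ , _) r≤q q<q′ =
  replies (¬IsP⇒IsN {position n q r q≤n r≤q}
    λ isP → ¬row₂ P q<q′ (sym (m≥n⇒m⊓n≡n r≤q)) (q≤n , r≤q , isP))
  where
  q≤n : q ≤ n
  q≤n = ≤-trans (<⇒≤ q<q′) q′≤n

  replies : IsN (position n q r q≤n r≤q) → _
  replies emptyIsN = contradiction (≤-trans q<q′ q′≤n) n≮0
  replies (someMoveToP (row₁ i) isP) with <-≤-connex q (toℕ i)
  ... | inj₁ q<i = inj₂ (toℕ i , q<i , toℕ<n i , <⇒≤ q<i , r≤q ,
    subst IsP (position-cong refl (m≥n⇒m⊓n≡n (<⇒≤ q<i))
      (m≥n⇒m⊓n≡n (≤-trans r≤q (<⇒≤ q<i)))) isP)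
  -- A cut at `i ≤ q` erases the difference between second rows `q` and `q′`.
  ... | inj₂ i≤q = contradiction
    (m⊓n≤m (toℕ i) q , ⊓-monoʳ-≤ (toℕ i) r≤q , isP)
    (¬row₁ P (toℕ<n i)
      (trans (m≤n⇒m⊓n≡m i≤q) (sym (m≤n⇒m⊓n≡m (≤-trans i≤q (<⇒≤ q<q′))))) refl)
  replies (someMoveToP (row₂ i) isP) = contradiction
    (≤-trans (<⇒≤ (toℕ<n i)) q≤n , m⊓n≤m (toℕ i) r , isP)
    (¬row₂ P (<-trans (toℕ<n i) q<q′) refl)
  replies (someMoveToP (row₃ i) isP) =
    inj₁ (toℕ i , toℕ<n i , q≤n , ≤-trans (<⇒≤ (toℕ<n i)) r≤q , isP)

module _ {n b : ℕ} (P : P[ n , n , b ]) where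

  P-in-column : ∀ {q} → b ≤ q → q ≤ n → ∃ λ r → r ≤ b × P[ n , q , r ]
  P-in-column {q} b≤q q≤n = <-rec Claim step (n ∸ q) q (m+[n∸m]≡n q≤n) b≤q
    where
    Claim : ℕ → Set
    Claim d = ∀ q → q + d ≡ n → b ≤ q → ∃ λ r → r ≤ b × P[ n , q , r ]

    step : ∀ d → (∀ {d′} → d′ < d → Claim d′) → Claim d
    -- Here `q` is `n`, and the given P-position serves.
    step zero _ q q+0≡n b≤q =
      b , ≤-refl , subst P[ n ,_, b ] (trans (sym q+0≡n) (+-identityʳ q)) P
    step (suc d) rec q q+1+d≡n b≤q = conclude (search reply)
      where
      -- These are the `suc d` second-row lengths from `suc q` to `n`.
      col : Fin (suc d) → ℕ
      col i = suc q + toℕ i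

      q<col : ∀ i → q < col i
      q<col i = m≤m+n (suc q) (toℕ i)

      1+q+d≡n : suc q + d ≡ n
      1+q+d≡n = trans (sym (+-suc q d)) q+1+d≡n

      inCol : ∀ i → ∃ λ r → r ≤ b × P[ n , col i , r ]
      inCol i = rec (s≤s (m∸n≤m d (toℕ i))) (col i)
        (trans (+-assoc (suc q) (toℕ i) _)
          (trans (cong (suc q +_) (m+[n∸m]≡n (s≤s⁻¹ (toℕ<n i)))) 1+q+d≡n))
        (≤-trans b≤q (<⇒≤ (q<col i)))

      row : Fin (suc d) → ℕ
      row i = proj₁ (inCol i)

      row≤q : ∀ i → row i ≤ q
      row≤q i = ≤-trans (proj₁ (proj₂ (inCol i))) b≤q

      reply : ∀ i → (∃ λ r′ → r′ < row i × P[ n , q , r′ ]) ⊎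
                    (∃ λ s → q < s × s < n × P[ s , q , row i ])
      reply i = winning-reply (proj₂ (proj₂ (inCol i))) (row≤q i) (q<col i)

      -- With equal third rows, the longer second row could be cut to the shorter one, a move from P
      -- to P.
      row-injective : ∀ {i j} → toℕ i < toℕ j → row i ≢ row j
      row-injective {i} {j} i<j eq =
        ¬row₂ (proj₂ (proj₂ (inCol j))) (+-monoʳ-< (suc q) i<j)
          (trans eq (sym (m≥n⇒m⊓n≡n (≤-trans (row≤q j) (<⇒≤ (q<col i))))))
          (proj₂ (proj₂ (inCol i)))

      conclude : (∃ λ i → ∃ λ r′ → r′ < row i × P[ n , q , r′ ]) ⊎
                 (∀ i → ∃ λ s → q < s × s < n × P[ s , q , row i ]) →
                 ∃ λ r → r ≤ b × P[ n , q , r ]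
      conclude (inj₁ (i , r′ , r′<r , P′)) =
        r′ , ≤-trans (<⇒≤ r′<r) (proj₁ (proj₂ (inCol i))) , P′
      conclude (inj₂ f) =
        -- Each `s` lies strictly between `q` and `n`, so its offset from `suc q` takes only `d`
        -- values, for `suc d` indices.
        contradiction (pigeonhole (n<1+n d) (λ i → fromℕ< (offset<d i))) no-collision
        where
        offset<d : ∀ i → proj₁ (f i) ∸ suc q < d
        offset<d i with f i
        ... | s , q<s , s<n , _ = subst (s ∸ suc q <_)
          (trans (cong (_∸ suc q) (sym 1+q+d≡n)) (m+n∸m≡n (suc q) d)) (∸-monoˡ-< s<n q<s)

        no-collision : ¬ ∃₂ λ i j → toℕ i < toℕ j × fromℕ< (offset<d i) ≡ fromℕ< (offset<d j)
        no-collision (i , j , i<j , eq) with f i | f j | fromℕ<-injective _ _ (offset<d i) (offset<d j) eq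
        ... | s , q<s , _ , Pᵢ | t , q<t , _ , Pⱼ | eq′ with ∸-cancelʳ-≡ q<s q<t eq′
        -- Both positions now differ at most in the third row, so unequal third rows would give a
        -- move from P to P.
        ... | refl with <-cmp (row i) (row j)
        ... | tri< r<r′ _ _ = ¬row₃ Pⱼ r<r′ Pᵢ
        ... | tri≈ _ r≡r′ _ = row-injective i<j r≡r′
        ... | tri> _ _ r>r′ = ¬row₃ Pᵢ r>r′ Pⱼ

  ¬P-second-row : ∀ {a} → a < n → ¬ P[ n , a , a ]
  ¬P-second-row {a} a<n P′ with <-≤-connex b a
  -- Cutting the second row at `a ≤ b` shortens the third row to `a` as well.
  ... | inj₂ a≤b = ¬row₂ P a<n (sym (m≤n⇒m⊓n≡m a≤b)) P′
  ... | inj₁ b<a with P-in-column (<⇒≤ b<a) (<⇒≤ a<n)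
  ...   | r , r≤b , P″ = ¬row₃ P′ (≤-<-trans r≤b b<a) P″

-- Strategy stealing: if the rectangle were P, taking its last corner would leave an N-position, but
-- every reply there leads to a position that the rectangle reaches in one move.
¬IsP-rectangle : ∀ n → ¬ IsP (rectangle n)
¬IsP-rectangle zero    (allMovesToN x≢∅ _) = x≢∅ refl
¬IsP-rectangle (suc n) isP = steal
  (¬IsP⇒IsN λ isP′ → ¬row₃ (≤-refl , ≤-refl , isP) (n<1+n n) (≤-refl , n≤1+n n , isP′))
  where
  -- A cut in the first or second row leaves at most `n` squares in the third row, so the corner is
  -- gone either way.
  min : ∀ {a} → a < suc n → a ⊓ suc n ≡ a ⊓ n
  min a<1+n = trans (m≤n⇒m⊓n≡m (<⇒≤ a<1+n)) (sym (m≤n⇒m⊓n≡m (s≤s⁻¹ a<1+n)))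

  steal : ¬ IsN (position (suc n) (suc n) n ≤-refl (n≤1+n n))
  steal (someMoveToP (row₁ a) isP′) =
    no-P-move isP (row₁ a) (position-cong refl refl (min (toℕ<n a))) isP′
  steal (someMoveToP (row₂ a) isP′) =
    no-P-move isP (row₂ a) (position-cong refl refl (min (toℕ<n a))) isP′
  steal (someMoveToP (row₃ b) isP′) =
    ¬row₃ (≤-refl , ≤-refl , isP) (m<n⇒m<1+n (toℕ<n b))
      (≤-refl , <⇒≤ (m<n⇒m<1+n (toℕ<n b)) , isP′)

module _ {n : ℕ} where

  -- A first-row move leaves a smaller rectangle.
  opening₁ : ∀ a → ¬ Winning (rectangle n) (row₁ a)
  opening₁ a isP = ¬IsP-rectangle (toℕ a) (subst IsP (position-cong refl a⊓n≡a a⊓n≡a) isP)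
    where a⊓n≡a = m≤n⇒m⊓n≡m (<⇒≤ (toℕ<n a))

  opening₂ : ∀ a → Winning (rectangle n) (row₂ a) → P[ n , toℕ a , toℕ a ]
  opening₂ a isP = <⇒≤ (toℕ<n a) , ≤-refl ,
    subst IsP (position-cong refl refl (m≤n⇒m⊓n≡m (<⇒≤ (toℕ<n a)))) isP

  opening₃ : ∀ b → Winning (rectangle n) (row₃ b) → P[ n , n , toℕ b ]
  opening₃ b isP = ≤-refl , <⇒≤ (toℕ<n b) , isP

  ¬P-second-row-twice : ∀ {a a′} → a < a′ → P[ n , a′ , a′ ] → ¬ P[ n , a , a ]
  ¬P-second-row-twice a<a′ P = ¬row₂ P a<a′ (sym (m≤n⇒m⊓n≡m (<⇒≤ a<a′)))

  winning-unique : ∀ m m′ → Winning (rectangle n) m → Winning (rectangle n) m′ → m ≡ m′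
  winning-unique (row₁ a) _ w _ = contradiction w (opening₁ a)
  winning-unique _ (row₁ a) _ w = contradiction w (opening₁ a)
  winning-unique (row₂ a) (row₂ a′) w w′ with <-cmp (toℕ a) (toℕ a′)
  ... | tri< a<a′ _ _ = contradiction (opening₂ a w) (¬P-second-row-twice a<a′ (opening₂ a′ w′))
  ... | tri≈ _ a≡a′ _ = cong row₂ (toℕ-injective a≡a′)
  ... | tri> _ _ a>a′ = contradiction (opening₂ a′ w′) (¬P-second-row-twice a>a′ (opening₂ a w))
  winning-unique (row₃ b) (row₃ b′) w w′ with <-cmp (toℕ b) (toℕ b′)
  ... | tri< b<b′ _ _ = contradiction (opening₃ b w) (¬row₃ (opening₃ b′ w′) b<b′)
  ... | tri≈ _ b≡b′ _ = cong row₃ (toℕ-injective b≡b′)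
  ... | tri> _ _ b>b′ = contradiction (opening₃ b′ w′) (¬row₃ (opening₃ b w) b>b′)
  winning-unique (row₂ a) (row₃ b) w w′ =
    contradiction (opening₂ a w) (¬P-second-row (opening₃ b w′) (toℕ<n a))
  winning-unique (row₃ b) (row₂ a) w w′ =
    contradiction (opening₂ a w′) (¬P-second-row (opening₃ b w) (toℕ<n a))

theorem1p1 : (n : ℕ) → .{{_ : NonZero n}} → ∃! _≡_ (Winning (rectangle n))
theorem1p1 n@(suc _) with ¬IsP⇒IsN (¬IsP-rectangle n)
-- The board is nonempty, which excludes `emptyIsN` and yields the winning move.
... | someMoveToP m w = m , w , λ {m′} w′ → winning-unique m m′ w w′
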